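{- For every $C>0$ there exists $c>0$ such that the following holds. If $d\geq 2$ is an integer and $D$ is a finite $(C,d)$-regular digraph with girth $g$, then $D$ contains a directed path of length at least $\frac{c\,d\,g}{\log d}$.
   Context: A digraph $D$ is $(C,d)$-regular if $d^+(v)\geq d$ and $d^-(v)\leq Cd$ for every vertex $v$ (out-degree and in-degree respectively). The girth is the minimum length of a directed cycle. Path length counts arcs. -}

module Defs where

open import Data.Nat using (ℕ; zero; suc; _≤_; _<_; _*_; _+_)
open import Data.Fin using (Fin; zero; suc; inject₁; fromℕ)
open import Data.Bool using (Bool; true; false; if_then_else_; T)
open import Data.List using (List; map; allFin)
open import Data.Nat.ListAction using (sum)
open import Data.Empty using (⊥)
open import Data.Integer using (+_)
open import Data.Rational using (ℚ; _/_) renaming (_≤_ to _≤ℚ_; _*_ to _*ℚ_)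
open import Data.Product using (Σ; _×_; ∃)
open import Function.Definitions using (Injective)
open import Relation.Binary.PropositionalEquality using (_≡_)

record Digraph (n : ℕ) : Set where
  field
    arc : Fin n → Fin n → Bool
open Digraph public

ℕtoℚ : ℕ → ℚ
ℕtoℚ k = + k / 1

outdeg : ∀ {n} → Digraph n → Fin n → ℕ
outdeg {n} D v = sum (map (λ w → if arc D v w then 1 else 0) (allFin n))

indeg : ∀ {n} → Digraph n → Fin n → ℕ
indeg {n} D v = sum (map (λ u → if arc D u v then 1 else 0) (allFin n))

Regular : ∀ {n} → ℚ → ℕ → Digraph n → Set
Regular C d D = ∀ v → (d ≤ outdeg D v) × (ℕtoℚ (indeg D v) ≤ℚ C *ℚ ℕtoℚ d)

IsPath : ∀ {n} → Digraph n → (L : ℕ) → (Fin (suc L) → Fin n) → Set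
IsPath D L p = Injective _≡_ _≡_ p × (∀ (i : Fin L) → T (arc D (p (inject₁ i)) (p (suc i))))

HasPath : ∀ {n} → Digraph n → ℕ → Set
HasPath {n} D L = Σ (Fin (suc L) → Fin n) (IsPath D L)

IsCycle : ∀ {n} → Digraph n → (m : ℕ) → (Fin (suc m) → Fin n) → Set
IsCycle D m p = Injective _≡_ _≡_ p
  × (∀ (i : Fin m) → T (arc D (p (inject₁ i)) (p (suc i))))
  × T (arc D (p (fromℕ m)) (p zero))

HasCycleOfLength : ∀ {n} → Digraph n → ℕ → Set
HasCycleOfLength D zero = ⊥
HasCycleOfLength {n} D (suc m) = Σ (Fin (suc m) → Fin n) (IsCycle D m)

Girth : ∀ {n} → Digraph n → ℕ → Set
Girth D g = HasCycleOfLength D g × (∀ k → HasCycleOfLength D k → g ≤ k)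

{-# OPTIONS --safe #-}
module Submission where

-- Let k be about d / log d. By the Lovász local lemma the vertices can be coloured with k
-- colours so that every vertex has an out-neighbour of every colour: keep exactly d out-arcs
-- at each vertex, so that the event "v misses some colour" has probability at most
-- k (1 - 1/k)^d and depends on at most C d² other such events. Now walk through g vertices of
-- the first colour, then g vertices of the second one, and so on. Two equal vertices of the
-- walk would have the same colour, hence be less than g steps apart and give a cycle shorter
-- than g. So the walk is a path with k g vertices.
--
-- The constant is c = log (p / q), where p = q + 1 = 2 m and m depends only on C: since
-- (p / q)^m ≤ 2, a path of length L with d g ≤ m L log₂ d satisfies (p / q)^(d g) ≤ d^L.

open import Defs
open import Data.Bool using (Bool; true; false; T; _∧_; if_then_else_)
open import Data.Bool.Properties using (T-≡)
open import Data.Fin using (Fin; zero; suc; toℕ; fromℕ; combine; finToFun; _↑ˡ_; _↑ʳ_)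
open import Data.Fin.Properties using (any?; remQuot-combine; toℕ<n; toℕ-inject₁; toℕ-fromℕ; toℕ-fromℕ<) renaming (_≟_ to _≟ᶠ_; _<?_ to _<ᶠ?_; <-cmp to <ᶠ-cmp)
open import Data.Fin.Subset using (Subset; inside; outside; _∈_; _∉_; _⊆_; _∩_; ∣_∣; Nonempty; ⊥; ⁅_⁆)
open import Data.Fin.Subset.Properties using (_∈?_; nonempty?; x∈p∩q⁺; x∈p⇒∣p-x∣<∣p∣; x∈⁅x⁆; ∣⁅x⁆∣≡1; ∣⊥∣≡0; ⊥⊆; s⊆s; p⊆q⇒∣p∣≤∣q∣)
open import Data.Integer as ℤ using (-[1+_])
import Data.Integer.Properties as ℤ
open import Data.List as List using (List; []; _∷_; length; filter; allFin)
open import Data.List.Membership.Propositional using () renaming (_∈_ to _∈ᴸ_)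
open import Data.List.Membership.Propositional.Properties using (∈-allFin; ∈-filter⁻)
open import Data.List.Properties using (map-tabulate; filter-notAll)
open import Data.List.Relation.Binary.Sublist.Propositional using (⊆-refl; _∷ʳ_) renaming (_⊆_ to _⊆ᴸ_)
open import Data.List.Relation.Binary.Sublist.Propositional.Properties using (length-mono-≤; filter⁺; filter-⊆)
open import Data.List.Relation.Unary.All as All using (All; []; _∷_)
open import Data.List.Relation.Unary.All.Properties using (all-filter)
open import Data.List.Relation.Unary.Any as Any using ()
open import Data.Nat using (ℕ; zero; suc; pred; _+_; _*_; _∸_; _^_; ⌊_/2⌋; ⌈_/2⌉; _≤_; _<_; z≤n; s≤s; z<s; NonZero; >-nonZero; >-nonZero⁻¹)
open import Data.Nat.DivMod using (_/_; _%_; _mod_; m≡m%n+[m/n]*n; m%n<n; m/n*n≤m; m/n≤m; m<n⇒m%n≡m; m<n*o⇒m/o<n)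
open import Data.Nat.Induction using (<-wellFounded; Acc; acc)
open import Data.Nat.ListAction using (product) renaming (sum to sumᴸ)
open import Data.Nat.Logarithm using (⌊log₂_⌋; ⌊log₂⌋-mono-≤; ⌊log₂[2^n]⌋≡n)
open import Data.Nat.Logarithm.Core using (⌊log2⌋)
open import Data.Nat.Properties
open import Data.Nat.Tactic.RingSolver using (solve-∀)
open import Data.Product using (Σ; ∃; _×_; _,_; proj₁; proj₂)
open import Data.Rational as ℚ using (ℚ; 0ℚ; mkℚ; toℚᵘ; ↥_) renaming (_<_ to _<ℚ_)
import Data.Rational.Properties as ℚ
open import Data.Rational.Unnormalised as ℚᵘ using (mkℚᵘ; *≤*; _≃_)
import Data.Rational.Unnormalised.Properties as ℚᵘ
open import Data.Sum using (inj₁; inj₂)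
open import Data.Vec using ([]; _∷_; lookup; tabulate; here; there)
open import Data.Vec.Functional using () renaming (_∷_ to _∷ᶠ_)
open import Data.Vec.Properties using (lookup-zipWith; lookup∘tabulate; lookup⇒[]=; []=⇒lookup)
open import Function using (_∘_; id; Equivalence)
open import Relation.Binary using (Rel; Decidable; tri<; tri≈; tri>)
open import Relation.Binary.PropositionalEquality using (_≡_; _≢_; _≗_; refl; sym; trans; cong; cong₂; subst; subst₂; module ≡-Reasoning)
open import Relation.Nullary using (¬_; Dec; yes; no; does; ¬?; contradiction; _×-dec_)
open import Relation.Unary as U using (Pred)
open import Relation.Unary.Properties using (∁?)
open import Algebra.Properties.Semiring.Sum +-*-semiring using (sum; sum-syntax; sum-cong-≗; ∑-distrib-+; ∑-comm; *-distribˡ-sum; *-distribʳ-sum)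
open import Algebra.Properties.CommutativeSemigroup *-commutativeSemigroup using (interchange; x∙yz≈y∙xz; x∙yz≈yx∙z; xy∙z≈y∙xz)

-- Powers and logarithms

-- Bernoulli's inequality (1 + x)^m ≥ 1 + m x for x = r / q and, below, for x = - r / (r + q).
bernoulli : ∀ q r m → (q + m * r) * q ^ m ≤ q * (r + q) ^ m
bernoulli q r zero    = ≤-reflexive (cong (_* 1) (+-identityʳ q))
bernoulli q r (suc m) = begin
  (q + suc m * r) * (q * q ^ m)                        ≤⟨ m≤m+n _ (m * r * r * q ^ m) ⟩
  (q + suc m * r) * (q * q ^ m) + m * r * r * q ^ m    ≡⟨ factor q r m (q ^ m) ⟩
  (r + q) * ((q + m * r) * q ^ m)                      ≤⟨ *-monoʳ-≤ (r + q) (bernoulli q r m) ⟩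
  (r + q) * (q * (r + q) ^ m)                          ≡⟨ x∙yz≈y∙xz (r + q) q ((r + q) ^ m) ⟩
  q * (r + q) ^ suc m                                  ∎
  where
  open ≤-Reasoning
  factor : ∀ q r m x → (q + (1 + m) * r) * (q * x) + m * r * r * x ≡ (r + q) * ((q + m * r) * x)
  factor = solve-∀

bernoulli⁻ : ∀ q r m → (r + q) * (r + q) ^ m ≤ (r + q) * q ^ m + m * r * (r + q) ^ m
bernoulli⁻ q r zero    = m≤m+n _ 0
bernoulli⁻ q r (suc m) = begin
  p * (p * p ^ m)                                        ≤⟨ *-monoʳ-≤ p (bernoulli⁻ q r m) ⟩
  p * (p * q ^ m + m * r * p ^ m)                        ≡⟨ expand q r m (q ^ m) (p ^ m) ⟩
  p * r * q ^ m + (p * q ^ suc m + m * r * p ^ suc m)    ≤⟨ +-monoˡ-≤ _ (*-monoʳ-≤ (p * r) qᵐ≤pᵐ) ⟩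
  p * r * p ^ m + (p * q ^ suc m + m * r * p ^ suc m)    ≡⟨ collect p r m (q ^ suc m) (p ^ m) ⟩
  p * q ^ suc m + suc m * r * p ^ suc m                  ∎
  where
  open ≤-Reasoning
  p = r + q
  qᵐ≤pᵐ : q ^ m ≤ p ^ m
  qᵐ≤pᵐ = ^-monoˡ-≤ m (m≤n+m q r)
  expand : ∀ q r m x y → (r + q) * ((r + q) * x + m * r * y) ≡
                         (r + q) * r * x + ((r + q) * (q * x) + m * r * ((r + q) * y))
  expand = solve-∀
  collect : ∀ p r m x y → p * r * y + (p * x + m * r * (p * y)) ≡ p * x + (1 + m) * r * (p * y)
  collect = solve-∀

2*q^m≤[r+q]^m : ∀ q r m .{{_ : NonZero q}} → q ≤ m * r → 2 * q ^ m ≤ (r + q) ^ m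
2*q^m≤[r+q]^m q r m q≤mr = *-cancelˡ-≤ q (begin
  q * (2 * q ^ m)        ≡⟨ double q (q ^ m) ⟩
  (q + q) * q ^ m        ≤⟨ *-monoˡ-≤ (q ^ m) (+-monoʳ-≤ q q≤mr) ⟩
  (q + m * r) * q ^ m    ≤⟨ bernoulli q r m ⟩
  q * (r + q) ^ m        ∎)
  where
  open ≤-Reasoning
  double : ∀ q x → q * (2 * x) ≡ (q + q) * x
  double = solve-∀

[r+q]^m≤2*q^m : ∀ q r m .{{_ : NonZero q}} → 2 * (m * r) ≤ r + q → (r + q) ^ m ≤ 2 * q ^ m
[r+q]^m≤2*q^m q r m 2mr≤p = *-cancelˡ-≤ p {{p≢0}} (+-cancelʳ-≤ (p * p ^ m) _ _ (begin
  p * p ^ m + p * p ^ m                    ≡⟨ double p (p ^ m) ⟩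
  2 * (p * p ^ m)                          ≤⟨ *-monoʳ-≤ 2 (bernoulli⁻ q r m) ⟩
  2 * (p * q ^ m + m * r * p ^ m)          ≡⟨ distribute p (m * r) (q ^ m) (p ^ m) ⟩
  p * (2 * q ^ m) + 2 * (m * r) * p ^ m    ≤⟨ +-monoʳ-≤ (p * (2 * q ^ m)) (*-monoˡ-≤ (p ^ m) 2mr≤p) ⟩
  p * (2 * q ^ m) + p * p ^ m              ∎))
  where
  open ≤-Reasoning
  p = r + q
  p≢0 : NonZero p
  p≢0 = >-nonZero (<-≤-trans (>-nonZero⁻¹ q) (m≤n+m q r))
  double : ∀ p x → p * x + p * x ≡ 2 * (p * x)
  double = solve-∀
  distribute : ∀ p s x y → 2 * (p * x + s * y) ≡ p * (2 * x) + 2 * s * y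
  distribute = solve-∀

^-distribʳ-* : ∀ a b n → (a * b) ^ n ≡ a ^ n * b ^ n
^-distribʳ-* a b zero    = refl
^-distribʳ-* a b (suc n) = trans (cong (a * b *_) (^-distribʳ-* a b n)) (interchange a b (a ^ n) (b ^ n))

[c*b^m]^s≡c^s*b^[m*s] : ∀ c b m s → (c * b ^ m) ^ s ≡ c ^ s * b ^ (m * s)
[c*b^m]^s≡c^s*b^[m*s] c b m s = trans (^-distribʳ-* c (b ^ m) s) (cong (c ^ s *_) (^-*-assoc b m s))

c^s*b^e≤a^e : ∀ {a b c e} m s → b ≤ a → c * b ^ m ≤ a ^ m → m * s ≤ e → c ^ s * b ^ e ≤ a ^ e
c^s*b^e≤a^e {a} {b} {c} {e} m s b≤a cbᵐ≤aᵐ ms≤e = begin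
  c ^ s * b ^ e                    ≡⟨ cong (λ x → c ^ s * b ^ x) (m+[n∸m]≡n ms≤e) ⟨
  c ^ s * b ^ (m * s + r)          ≡⟨ cong (c ^ s *_) (^-distribˡ-+-* b (m * s) r) ⟩
  c ^ s * (b ^ (m * s) * b ^ r)    ≡⟨ *-assoc (c ^ s) _ _ ⟨
  c ^ s * b ^ (m * s) * b ^ r      ≡⟨ cong (_* b ^ r) ([c*b^m]^s≡c^s*b^[m*s] c b m s) ⟨
  (c * b ^ m) ^ s * b ^ r          ≤⟨ *-mono-≤ (^-monoˡ-≤ s cbᵐ≤aᵐ) (^-monoˡ-≤ r b≤a) ⟩
  (a ^ m) ^ s * a ^ r              ≡⟨ cong (_* a ^ r) (^-*-assoc a m s) ⟩
  a ^ (m * s) * a ^ r              ≡⟨ ^-distribˡ-+-* a (m * s) r ⟨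
  a ^ (m * s + r)                  ≡⟨ cong (a ^_) (m+[n∸m]≡n ms≤e) ⟩
  a ^ e                            ∎
  where
  open ≤-Reasoning
  r = e ∸ m * s

a^e≤c^s*b^e : ∀ {a b c e} .{{_ : NonZero b}} m s →
  b ≤ a → a ^ m ≤ c * b ^ m → e ≤ m * s → a ^ e ≤ c ^ s * b ^ e
a^e≤c^s*b^e {a} {b} {c} {e} m s b≤a aᵐ≤cbᵐ e≤ms = *-cancelʳ-≤ _ _ (b ^ r) {{m^n≢0 b r}} (begin
  a ^ e * b ^ r              ≤⟨ *-monoʳ-≤ (a ^ e) (^-monoˡ-≤ r b≤a) ⟩
  a ^ e * a ^ r              ≡⟨ ^-distribˡ-+-* a e r ⟨
  a ^ (e + r)                ≡⟨ cong (a ^_) (m+[n∸m]≡n e≤ms) ⟩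
  a ^ (m * s)                ≡⟨ ^-*-assoc a m s ⟨
  (a ^ m) ^ s                ≤⟨ ^-monoˡ-≤ s aᵐ≤cbᵐ ⟩
  (c * b ^ m) ^ s            ≡⟨ [c*b^m]^s≡c^s*b^[m*s] c b m s ⟩
  c ^ s * b ^ (m * s)        ≡⟨ cong (λ x → c ^ s * b ^ x) (m+[n∸m]≡n e≤ms) ⟨
  c ^ s * b ^ (e + r)        ≡⟨ cong (c ^ s *_) (^-distribˡ-+-* b e r) ⟩
  c ^ s * (b ^ e * b ^ r)    ≡⟨ *-assoc (c ^ s) _ _ ⟨
  c ^ s * b ^ e * b ^ r      ∎)
  where
  open ≤-Reasoning
  r = m * s ∸ e

n≤2^n : ∀ n → n ≤ 2 ^ n
n≤2^n zero    = z≤n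
n≤2^n (suc n) = +-mono-≤ (m^n>0 2 n) (≤-trans (n≤2^n n) (m≤m+n (2 ^ n) 0))

2^⌊log₂n⌋≤n : ∀ n .{{_ : NonZero n}} → 2 ^ ⌊log₂ n ⌋ ≤ n
2^⌊log₂n⌋≤n (suc n) = 2^⌊log2⌋≤ n (<-wellFounded (suc n))
  where
  2^⌊log2⌋≤ : ∀ n (rec : Acc _<_ (suc n)) → 2 ^ ⌊log2⌋ (suc n) rec ≤ suc n
  2^⌊log2⌋≤ zero    _         = ≤-refl
  2^⌊log2⌋≤ (suc n) (acc rec) = begin
    2 * 2 ^ ⌊log2⌋ (suc ⌊ n /2⌋) _    ≤⟨ *-monoʳ-≤ 2 (2^⌊log2⌋≤ ⌊ n /2⌋ _) ⟩
    2 * suc ⌊ n /2⌋                   ≡⟨ distribute ⌊ n /2⌋ ⟩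
    2 + (⌊ n /2⌋ + ⌊ n /2⌋)           ≤⟨ +-monoʳ-≤ 2 (+-monoʳ-≤ ⌊ n /2⌋ (⌊n/2⌋≤⌈n/2⌉ n)) ⟩
    2 + (⌊ n /2⌋ + ⌈ n /2⌉)           ≡⟨ cong (2 +_) (⌊n/2⌋+⌈n/2⌉≡n n) ⟩
    2 + n                             ∎
    where
    open ≤-Reasoning
    distribute : ∀ h → 2 * (1 + h) ≡ 2 + (h + h)
    distribute = solve-∀

n<2^[1+⌊log₂n⌋] : ∀ n → n < 2 ^ suc ⌊log₂ n ⌋
n<2^[1+⌊log₂n⌋] n = ≰⇒> λ 2^[1+ℓ]≤n →
  1+n≰n (subst (_≤ ⌊log₂ n ⌋) (⌊log₂[2^n]⌋≡n (suc ⌊log₂ n ⌋)) (⌊log₂⌋-mono-≤ 2^[1+ℓ]≤n))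

-- Since pred truncates, suc (pred k) is max 1 k.
2^t*[k-1]^d≤k^d : ∀ k {t d} .{{_ : NonZero d}} → k * t ≤ d → 2 ^ t * pred k ^ d ≤ suc (pred k) ^ d
2^t*[k-1]^d≤k^d zero              {t} {suc d} _    = ≤-trans (≤-reflexive (*-zeroʳ (2 ^ t))) z≤n
2^t*[k-1]^d≤k^d (suc zero)        {t} {suc d} _    = ≤-trans (≤-reflexive (*-zeroʳ (2 ^ t))) z≤n
2^t*[k-1]^d≤k^d k@(suc j@(suc _)) {t}         kt≤d =
  c^s*b^e≤a^e {c = 2} k t (n≤1+n j) (2*q^m≤[r+q]^m j 1 k (≤-trans (n≤1+n j) (m≤m*n k 1))) kt≤d

∃k-2^t*[k-1]^d≤k^d : ∀ t d .{{_ : NonZero t}} .{{_ : NonZero d}} →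
  ∃ λ j → suc j ≤ d × d ≤ 2 * t * suc j × 2 ^ t * j ^ d ≤ suc j ^ d
∃k-2^t*[k-1]^d≤k^d t d = j , j<d , d≤2tk , 2^t*[k-1]^d≤k^d (d / t) (m/n*n≤m d t)
  where
  open ≤-Reasoning
  j = pred (d / t)
  j<d : j < d
  j<d = subst (j <_) (suc-pred d) (s≤s (pred-mono-≤ (m/n≤m d t)))
  d≤2tk : d ≤ 2 * t * suc j
  d≤2tk = begin
    d                        ≡⟨ m≡m%n+[m/n]*n d t ⟩
    d % t + d / t * t        ≤⟨ +-mono-≤ (<⇒≤ (m%n<n d t)) (*-monoˡ-≤ t (m≤n+m∸n (d / t) 1)) ⟩
    t + suc j * t            ≤⟨ +-monoˡ-≤ (suc j * t) (m≤m+n t (j * t)) ⟩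
    suc j * t + suc j * t    ≡⟨ double t (suc j) ⟩
    2 * t * suc j            ∎
    where
    double : ∀ t k → k * t + k * t ≡ 2 * t * k
    double = solve-∀

4*2^a*d³≤2^[8+a]⌊log₂d⌋ : ∀ a {d} → 2 ≤ d → 4 * (2 ^ a * (d * (d * d))) ≤ 2 ^ ((8 + a) * ⌊log₂ d ⌋)
4*2^a*d³≤2^[8+a]⌊log₂d⌋ a {d} 2≤d = begin
  4 * (2 ^ a * (d * (d * d)))          ≤⟨ *-monoʳ-≤ 4 (*-monoʳ-≤ (2 ^ a) (*-mono-≤ d≤b (*-mono-≤ d≤b d≤b))) ⟩
  4 * (2 ^ a * (b * (b * b)))          ≡⟨ cube (2 ^ a) b ⟩
  2 ^ 2 * 2 ^ a * b ^ 3                ≡⟨ cong₂ _*_ (sym (^-distribˡ-+-* 2 2 a)) (^-*-assoc 2 (suc ℓ) 3) ⟩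
  2 ^ (2 + a) * 2 ^ (suc ℓ * 3)        ≡⟨ ^-distribˡ-+-* 2 (2 + a) (suc ℓ * 3) ⟨
  2 ^ (2 + a + suc ℓ * 3)              ≤⟨ ^-monoʳ-≤ 2 exponent ⟩
  2 ^ ((8 + a) * ℓ)                    ∎
  where
  open ≤-Reasoning
  ℓ = ⌊log₂ d ⌋
  b = 2 ^ suc ℓ
  d≤b : d ≤ b
  d≤b = <⇒≤ (n<2^[1+⌊log₂n⌋] d)
  cube : ∀ c b → 4 * (c * (b * (b * b))) ≡ 2 ^ 2 * c * (b * (b * (b * 1)))
  cube = solve-∀
  exponent : 2 + a + suc ℓ * 3 ≤ (8 + a) * ℓ
  exponent = begin
    2 + a + suc ℓ * 3          ≡⟨ collect a ℓ ⟩
    (5 + a) * 1 + 3 * ℓ        ≤⟨ +-monoˡ-≤ (3 * ℓ) (*-monoʳ-≤ (5 + a) (⌊log₂⌋-mono-≤ 2≤d)) ⟩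
    (5 + a) * ℓ + 3 * ℓ        ≡⟨ factor a ℓ ⟩
    (8 + a) * ℓ                ∎
    where
    collect : ∀ a ℓ → 2 + a + (1 + ℓ) * 3 ≡ (5 + a) * 1 + 3 * ℓ
    collect = solve-∀
    factor : ∀ a ℓ → (5 + a) * ℓ + 3 * ℓ ≡ (8 + a) * ℓ
    factor = solve-∀

-- Sums and products

infixr 7 _⊙_

_⊙_ : ∀ {n} → (Fin n → ℕ) → (Fin n → ℕ) → Fin n → ℕ
(f ⊙ g) i = f i * g i

∑-mono-≤ : ∀ {n} {f g : Fin n → ℕ} → (∀ i → f i ≤ g i) → sum f ≤ sum g
∑-mono-≤ {zero}  f≤g = z≤n
∑-mono-≤ {suc n} f≤g = +-mono-≤ (f≤g zero) (∑-mono-≤ (f≤g ∘ suc))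

∑-const : ∀ n c → ∑[ _ < n ] c ≡ n * c
∑-const zero    c = refl
∑-const (suc n) c = cong (c +_) (∑-const n c)

∑≡0⇒≡0 : ∀ {n} (f : Fin n → ℕ) → sum f ≡ 0 → ∀ i → f i ≡ 0
∑≡0⇒≡0 f ∑≡0 zero    = m+n≡0⇒m≡0 (f zero) ∑≡0
∑≡0⇒≡0 f ∑≡0 (suc i) = ∑≡0⇒≡0 (f ∘ suc) (m+n≡0⇒n≡0 (f zero) ∑≡0) i

∑>0⇒∃>0 : ∀ {n} (f : Fin n → ℕ) → 0 < sum f → ∃ λ i → 0 < f i
∑>0⇒∃>0 {suc n} f ∑>0 with f zero in f0≡
... | suc _ = zero , subst (0 <_) (sym f0≡) z<s
... | zero  = let i , fi>0 = ∑>0⇒∃>0 (f ∘ suc) ∑>0 in suc i , fi>0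

∑-proportional : ∀ {n} a b (f g : Fin n → ℕ) → (∀ i → a * f i ≡ b * g i) → a * sum f ≡ b * sum g
∑-proportional a b f g af≗bg =
  trans (*-distribˡ-sum a f) (trans (sum-cong-≗ af≗bg) (sym (*-distribˡ-sum b g)))

∑-⊙-constant : ∀ {n} (f g : Fin n → ℕ) → (∀ i j → g i ≡ g j) → n * sum (f ⊙ g) ≡ sum f * sum g
∑-⊙-constant {zero}  f g g-constant = refl
∑-⊙-constant {suc n} f g g-constant = begin
  N * sum (f ⊙ g)                  ≡⟨ cong (N *_) (sum-cong-≗ λ i → cong (f i *_) (g-constant i zero)) ⟩
  N * ∑[ i < N ] (f i * g zero)    ≡⟨ cong (N *_) (*-distribʳ-sum (g zero) f) ⟨
  N * (sum f * g zero)             ≡⟨ x∙yz≈y∙xz N (sum f) (g zero) ⟩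
  sum f * (N * g zero)             ≡⟨ cong (sum f *_) (∑-const N (g zero)) ⟨
  sum f * ∑[ _ < N ] g zero        ≡⟨ cong (sum f *_) (sum-cong-≗ λ i → g-constant i zero) ⟨
  sum f * sum g                    ∎
  where
  open ≡-Reasoning
  N = suc n

∑-↑ : ∀ m {n} (f : Fin (m + n) → ℕ) → sum f ≡ ∑[ i < m ] f (i ↑ˡ n) + ∑[ j < n ] f (m ↑ʳ j)
∑-↑ zero    f = refl
∑-↑ (suc m) f = trans (cong (f zero +_) (∑-↑ m (f ∘ suc))) (sym (+-assoc (f zero) _ _))

∑-combine : ∀ m {n} (f : Fin (m * n) → ℕ) → sum f ≡ ∑[ i < m ] ∑[ j < n ] f (combine i j)
∑-combine zero        f = refl
∑-combine (suc m) {n} f = trans (∑-↑ n f) (cong (∑[ j < n ] f (j ↑ˡ (m * n)) +_) (∑-combine m (f ∘ (n ↑ʳ_))))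

∑-allFin : ∀ {n} (f : Fin n → ℕ) → sumᴸ (List.map f (allFin n)) ≡ sum f
∑-allFin f = trans (cong sumᴸ (map-tabulate id f)) (∑-tabulate f)
  where
  ∑-tabulate : ∀ {n} (f : Fin n → ℕ) → sumᴸ (List.tabulate f) ≡ sum f
  ∑-tabulate {zero}  f = refl
  ∑-tabulate {suc n} f = cong (f zero +_) (∑-tabulate (f ∘ suc))

length-filter≤sum-map : ∀ {a p} {A : Set a} {P : Pred A p} (P? : U.Decidable P) (f : A → ℕ) →
  (∀ {x} → P x → 0 < f x) → ∀ xs → length (filter P? xs) ≤ sumᴸ (List.map f xs)
length-filter≤sum-map P? f f>0 []       = z≤n
length-filter≤sum-map P? f f>0 (x ∷ xs) with P? x
... | yes Px = +-mono-≤ (f>0 Px) (length-filter≤sum-map P? f f>0 xs)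
... | no  _  = m≤n⇒m≤o+n (f x) (length-filter≤sum-map P? f f>0 xs)

product-map≤1 : ∀ {a} {A : Set a} {f : A → ℕ} → (∀ x → f x ≤ 1) → ∀ xs → product (List.map f xs) ≤ 1
product-map≤1 f≤1 []       = ≤-refl
product-map≤1 f≤1 (x ∷ xs) = *-mono-≤ (f≤1 x) (product-map≤1 f≤1 xs)

product-map>0⇒All>0 : ∀ {a} {A : Set a} (f : A → ℕ) xs → 0 < product (List.map f xs) → All (λ x → 0 < f x) xs
product-map>0⇒All>0 f []       _   = []
product-map>0⇒All>0 f (x ∷ xs) ∏>0 =
  >-nonZero⁻¹ (f x) {{m*n≢0⇒m≢0 (f x) {{>-nonZero ∏>0}}}} ∷
  product-map>0⇒All>0 f xs (>-nonZero⁻¹ _ {{m*n≢0⇒n≢0 (f x) {{>-nonZero ∏>0}}}})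

product-map-filter : ∀ {a p} {A : Set a} {P : Pred A p} (P? : U.Decidable P) (f : A → ℕ) xs →
  product (List.map f xs) ≡ product (List.map f (filter P? xs)) * product (List.map f (filter (∁? P?) xs))
product-map-filter P? f []       = refl
product-map-filter P? f (x ∷ xs) with does (P? x) | product-map-filter P? f xs
... | true  | ih = trans (cong (f x *_) ih) (sym (*-assoc (f x) _ _))
... | false | ih = trans (cong (f x *_) ih) (x∙yz≈y∙xz (f x) (product (List.map f (filter P? xs))) _)

-- The local lemma

-- The elements of Fin N are the outcomes. A bad event is replaced by an ℕ-valued variable that
-- should vanish: allVanish S is the indicator of an event, and sum (X v ⊙ allVanish S) bounds
-- from above the number of outcomes in this event that are bad for v.
module LocalLemma {i} {I : Set i} {N : ℕ} (X : I → Fin N → ℕ) where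

  vanishes : I → Fin N → ℕ
  vanishes v ω = 1 ∸ X v ω

  allVanish : List I → Fin N → ℕ
  allVanish S ω = product (List.map (λ u → vanishes u ω) S)

  allVanish⊙f≤f : ∀ S f ω → (allVanish S ⊙ f) ω ≤ f ω
  allVanish⊙f≤f S f ω = begin
    allVanish S ω * f ω    ≤⟨ *-monoˡ-≤ (f ω) (product-map≤1 (λ u → m∸n≤m 1 (X u ω)) S) ⟩
    1 * f ω                ≡⟨ *-identityˡ (f ω) ⟩
    f ω                    ∎
    where open ≤-Reasoning

  markov : ∀ v f → sum f ≤ sum (vanishes v ⊙ f) + sum (X v ⊙ f)
  markov v f = ≤-trans (∑-mono-≤ pointwise) (≤-reflexive (∑-distrib-+ (vanishes v ⊙ f) (X v ⊙ f)))
    where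
    1≤[1∸x]+x : ∀ x → 1 ≤ (1 ∸ x) + x
    1≤[1∸x]+x zero    = ≤-refl
    1≤[1∸x]+x (suc x) = m≤n⇒m≤o+n (0 ∸ x) z<s
    pointwise : ∀ ω → f ω ≤ (vanishes v ⊙ f) ω + (X v ⊙ f) ω
    pointwise ω = begin
      f ω                                ≡⟨ *-identityˡ (f ω) ⟨
      1 * f ω                            ≤⟨ *-monoˡ-≤ (f ω) (1≤[1∸x]+x (X v ω)) ⟩
      (vanishes v ω + X v ω) * f ω       ≡⟨ *-distribʳ-+ (f ω) (vanishes v ω) (X v ω) ⟩
      (vanishes v ⊙ f) ω + (X v ⊙ f) ω   ∎
      where open ≤-Reasoning

  union-bound : ∀ c f S → All (λ u → c * sum (X u ⊙ f) ≤ sum f) S →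
    c * sum f ≤ c * sum (allVanish S ⊙ f) + length S * sum f
  union-bound c f []      []                = begin
    c * sum f                           ≡⟨ cong (c *_) (sum-cong-≗ λ ω → *-identityˡ (f ω)) ⟨
    c * sum (allVanish [] ⊙ f)          ≤⟨ m≤m+n _ 0 ⟩
    c * sum (allVanish [] ⊙ f) + 0      ∎
    where open ≤-Reasoning
  union-bound c f (u ∷ S) (u-rare ∷ S-rare) = begin
    c * sum f
      ≤⟨ union-bound c f S S-rare ⟩
    c * sum (allVanish S ⊙ f) + length S * sum f
      ≤⟨ +-monoˡ-≤ (length S * sum f) (*-monoʳ-≤ c (markov u (allVanish S ⊙ f))) ⟩
    c * (sum (vanishes u ⊙ allVanish S ⊙ f) + sum (X u ⊙ allVanish S ⊙ f)) + length S * sum f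
      ≤⟨ +-monoˡ-≤ (length S * sum f) (*-monoʳ-≤ c (+-mono-≤
           (≤-reflexive (sum-cong-≗ λ ω → sym (*-assoc (vanishes u ω) (allVanish S ω) (f ω))))
           (∑-mono-≤ λ ω → *-monoʳ-≤ (X u ω) (allVanish⊙f≤f S f ω)))) ⟩
    c * (sum (allVanish (u ∷ S) ⊙ f) + sum (X u ⊙ f)) + length S * sum f
      ≡⟨ distribute c (sum (allVanish (u ∷ S) ⊙ f)) (sum (X u ⊙ f)) (length S * sum f) ⟩
    c * sum (allVanish (u ∷ S) ⊙ f) + (c * sum (X u ⊙ f) + length S * sum f)
      ≤⟨ +-monoʳ-≤ (c * sum (allVanish (u ∷ S) ⊙ f)) (+-monoˡ-≤ (length S * sum f) u-rare) ⟩
    c * sum (allVanish (u ∷ S) ⊙ f) + length (u ∷ S) * sum f ∎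
    where
    open ≤-Reasoning
    distribute : ∀ c x y z → c * (x + y) + z ≡ c * x + (c * y + z)
    distribute = solve-∀

  allVanish-half : ∀ {M} .{{_ : NonZero M}} f S →
    length S ≤ M → All (λ u → 2 * M * sum (X u ⊙ f) ≤ sum f) S → sum f ≤ 2 * sum (allVanish S ⊙ f)
  allVanish-half {M} f S ∣S∣≤M S-rare = *-cancelˡ-≤ M (+-cancelʳ-≤ (M * sum f) _ _ (begin
    M * sum f + M * sum f                               ≡⟨ double M (sum f) ⟩
    2 * M * sum f                                       ≤⟨ union-bound (2 * M) f S S-rare ⟩
    2 * M * sum (allVanish S ⊙ f) + length S * sum f    ≤⟨ +-monoʳ-≤ _ (*-monoˡ-≤ (sum f) ∣S∣≤M) ⟩
    2 * M * sum (allVanish S ⊙ f) + M * sum f           ≡⟨ cong (_+ M * sum f) (xy∙z≈y∙xz 2 M _) ⟩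
    M * (2 * sum (allVanish S ⊙ f)) + M * sum f         ∎))
    where
    open ≤-Reasoning
    double : ∀ m x → m * x + m * x ≡ 2 * m * x
    double = solve-∀

  module _ {ℓ} {_~_ : Rel I ℓ} (_~?_ : Decidable _~_) (M : ℕ) .{{_ : NonZero M}}
           (rare : ∀ v S → All (λ u → ¬ v ~ u) S → 4 * M * sum (X v ⊙ allVanish S) ≤ sum (allVanish S)) where

    Sparse : List I → Set i
    Sparse S = ∀ v → length (filter (v ~?_) S) ≤ M

    Sparse-⊆ : ∀ {R S} → R ⊆ᴸ S → Sparse S → Sparse R
    Sparse-⊆ R⊆S sparse v =
      ≤-trans (length-mono-≤ (filter⁺ (v ~?_) (v ~?_) (λ { refl v~u → v~u }) R⊆S)) (sparse v)

    -- Given that the variables far from v vanish, so do all those near v with probability at least 1/2.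
    rare-in-sparse : ∀ S → Acc _<_ (length S) → Sparse S → ∀ v →
      2 * M * sum (X v ⊙ allVanish S) ≤ sum (allVanish S)
    rare-in-sparse S (acc rec) sparse v = *-cancelˡ-≤ 2 (begin
      2 * (2 * M * sum (X v ⊙ allVanish S))       ≡⟨ quadruple M (sum (X v ⊙ allVanish S)) ⟩
      4 * M * sum (X v ⊙ allVanish S)             ≤⟨ *-monoʳ-≤ (4 * M) (∑-mono-≤ Xv⊙S≤Xv⊙far) ⟩
      4 * M * sum (X v ⊙ allVanish far)           ≤⟨ rare v far (all-filter (∁? (v ~?_)) S) ⟩
      sum (allVanish far)                         ≤⟨ allVanish-half (allVanish far) near (sparse v) near-rare ⟩
      2 * sum (allVanish near ⊙ allVanish far)    ≡⟨ cong (2 *_) (sum-cong-≗ S≗near⊙far) ⟨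
      2 * sum (allVanish S)                       ∎)
      where
      open ≤-Reasoning
      near far : List I
      near = filter (v ~?_) S
      far  = filter (∁? (v ~?_)) S
      S≗near⊙far : ∀ ω → allVanish S ω ≡ (allVanish near ⊙ allVanish far) ω
      S≗near⊙far ω = product-map-filter (v ~?_) (λ u → vanishes u ω) S
      Xv⊙S≤Xv⊙far : ∀ ω → (X v ⊙ allVanish S) ω ≤ (X v ⊙ allVanish far) ω
      Xv⊙S≤Xv⊙far ω = *-monoʳ-≤ (X v ω)
        (≤-trans (≤-reflexive (S≗near⊙far ω)) (allVanish⊙f≤f near (allVanish far) ω))
      ∣far∣<∣S∣ : ∀ {u} → u ∈ᴸ near → length far < length S
      ∣far∣<∣S∣ u∈near = let u∈S , v~u = ∈-filter⁻ (v ~?_) u∈near in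
        filter-notAll (∁? (v ~?_)) S (Any.map (λ { refl v≁u → v≁u v~u }) u∈S)
      near-rare : All (λ u → 2 * M * sum (X u ⊙ allVanish far) ≤ sum (allVanish far)) near
      near-rare = All.tabulate λ {u} u∈near →
        rare-in-sparse far (rec (∣far∣<∣S∣ u∈near)) (Sparse-⊆ (filter-⊆ (∁? (v ~?_)) S) sparse) u
      quadruple : ∀ m x → 2 * (2 * m * x) ≡ 4 * m * x
      quadruple = solve-∀

    ∑-allVanish>0 : .{{_ : NonZero N}} → ∀ S → Sparse S → 0 < sum (allVanish S)
    ∑-allVanish>0 []      _      = subst (0 <_) (sym (trans (∑-const N 1) (*-identityʳ N))) (>-nonZero⁻¹ N)
    ∑-allVanish>0 (v ∷ S) sparse = n≢0⇒n>0 λ ∑≡0 → <⇒≱ ∑S<∑S*2M (begin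
      sum (allVanish S) * (2 * M)
        ≡⟨ *-comm (sum (allVanish S)) (2 * M) ⟩
      2 * M * sum (allVanish S)
        ≤⟨ *-monoʳ-≤ (2 * M) (markov v (allVanish S)) ⟩
      2 * M * (sum (allVanish (v ∷ S)) + sum (X v ⊙ allVanish S))
        ≡⟨ cong (λ s → 2 * M * (s + sum (X v ⊙ allVanish S))) ∑≡0 ⟩
      2 * M * sum (X v ⊙ allVanish S)
        ≤⟨ rare-in-sparse S (<-wellFounded _) S-sparse v ⟩
      sum (allVanish S) ∎)
      where
      open ≤-Reasoning
      S-sparse : Sparse S
      S-sparse = Sparse-⊆ (v ∷ʳ ⊆-refl) sparse
      ∑S<∑S*2M : sum (allVanish S) < sum (allVanish S) * (2 * M)
      ∑S<∑S*2M = m<m*n _ (2 * M) {{>-nonZero (∑-allVanish>0 S S-sparse)}} (*-monoʳ-≤ 2 (>-nonZero⁻¹ M))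

    lovász-local-lemma : .{{_ : NonZero N}} → ∀ S → Sparse S → ∃ λ ω → All (λ u → X u ω ≡ 0) S
    lovász-local-lemma S sparse =
      let ω , allVanish>0 = ∑>0⇒∃>0 (allVanish S) (∑-allVanish>0 S sparse)
      in ω , All.map (n<1⇒n≡0 ∘ m∸n≢0⇒n<m ∘ n>0⇒n≢0)
                     (product-map>0⇒All>0 (λ u → vanishes u ω) S allVanish>0)

-- Subsets of finite sets

indicator : Bool → ℕ
indicator b = if b then 1 else 0

∣p∣≡∑indicator : ∀ {n} (p : Subset n) → ∣ p ∣ ≡ ∑[ i < n ] indicator (lookup p i)
∣p∣≡∑indicator []            = refl
∣p∣≡∑indicator (inside  ∷ p) = cong suc (∣p∣≡∑indicator p)
∣p∣≡∑indicator (outside ∷ p) = ∣p∣≡∑indicator p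

∣tabulate∣≡∑indicator : ∀ {n} (f : Fin n → Bool) → ∣ tabulate f ∣ ≡ sum (indicator ∘ f)
∣tabulate∣≡∑indicator f =
  trans (∣p∣≡∑indicator (tabulate f)) (sum-cong-≗ λ i → cong indicator (lookup∘tabulate f i))

∈-tabulate⁺ : ∀ {n} {f : Fin n → Bool} {i} → f i ≡ true → i ∈ tabulate f
∈-tabulate⁺ {f = f} {i} fi≡true = lookup⇒[]= i (tabulate f) (trans (lookup∘tabulate f i) fi≡true)

∈-tabulate⁻ : ∀ {n} {f : Fin n → Bool} {i} → i ∈ tabulate f → f i ≡ true
∈-tabulate⁻ {f = f} {i} i∈ = trans (sym (lookup∘tabulate f i)) ([]=⇒lookup i∈)

∃⊆-of-size : ∀ {n} d (p : Subset n) → d ≤ ∣ p ∣ → ∃ λ q → q ⊆ p × ∣ q ∣ ≡ d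
∃⊆-of-size {n} zero    p             _     = ⊥ , ⊥⊆ , ∣⊥∣≡0 n
∃⊆-of-size     (suc d) (inside  ∷ p) d≤∣p∣ =
  let q , q⊆p , ∣q∣≡d = ∃⊆-of-size d p (≤-pred d≤∣p∣) in inside ∷ q , s⊆s q⊆p , cong suc ∣q∣≡d
∃⊆-of-size     (suc d) (outside ∷ p) d≤∣p∣ =
  let q , q⊆p , ∣q∣≡d = ∃⊆-of-size (suc d) p d≤∣p∣ in outside ∷ q , s⊆s q⊆p , ∣q∣≡d

2≤∣p∣⇒∃≢ : ∀ {n} (p : Subset n) v → 2 ≤ ∣ p ∣ → ∃ λ w → w ∈ p × v ≢ w
2≤∣p∣⇒∃≢ p v 2≤∣p∣ with any? (λ w → (w ∈? p) ×-dec ¬? (v ≟ᶠ w))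
... | yes ∃≢ = ∃≢
... | no  ∄≢ = contradiction (p⊆q⇒∣p∣≤∣q∣ p⊆⁅v⁆) (<⇒≱ (subst (_< ∣ p ∣) (sym (∣⁅x⁆∣≡1 v)) 2≤∣p∣))
  where
  p⊆⁅v⁆ : p ⊆ ⁅ v ⁆
  p⊆⁅v⁆ {w} w∈p with v ≟ᶠ w
  ... | yes refl = x∈⁅x⁆ v
  ... | no  v≢w  = contradiction (w , w∈p , v≢w) ∄≢

∏∈ : ∀ {n} → Subset n → (Fin n → ℕ) → ℕ
∏∈ []            f = 1
∏∈ (inside  ∷ p) f = f zero * ∏∈ p (f ∘ suc)
∏∈ (outside ∷ p) f = ∏∈ p (f ∘ suc)

∏∈-cong : ∀ {n} (p : Subset n) {f g : Fin n → ℕ} → (∀ {i} → i ∈ p → f i ≡ g i) → ∏∈ p f ≡ ∏∈ p g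
∏∈-cong []            f≗g = refl
∏∈-cong (inside  ∷ p) f≗g = cong₂ _*_ (f≗g here) (∏∈-cong p (f≗g ∘ there))
∏∈-cong (outside ∷ p) f≗g = ∏∈-cong p (f≗g ∘ there)

∏∈≡0⇒∃≡0 : ∀ {n} (p : Subset n) (f : Fin n → ℕ) → ∏∈ p f ≡ 0 → ∃ λ i → i ∈ p × f i ≡ 0
∏∈≡0⇒∃≡0 (inside  ∷ p) f ∏≡0 with m*n≡0⇒m≡0∨n≡0 (f zero) ∏≡0
... | inj₁ f0≡0  = zero , here , f0≡0
... | inj₂ ∏≡0′  = let i , i∈p , fi≡0 = ∏∈≡0⇒∃≡0 p (f ∘ suc) ∏≡0′ in suc i , there i∈p , fi≡0
∏∈≡0⇒∃≡0 (outside ∷ p) f ∏≡0 = let i , i∈p , fi≡0 = ∏∈≡0⇒∃≡0 p (f ∘ suc) ∏≡0 in suc i , there i∈p , fi≡0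

-- Random colourings

Colouring : ℕ → ℕ → Set
Colouring n k = Fin n → Fin k

∑ᶜ : ∀ {n k} → (Colouring n k → ℕ) → ℕ
∑ᶜ {n} {k} h = ∑[ ω < k ^ n ] h (finToFun ω)

∑ᶜ-cong : ∀ {n k} {f g : Colouring n k → ℕ} → f ≗ g → ∑ᶜ f ≡ ∑ᶜ g
∑ᶜ-cong f≗g = sum-cong-≗ (f≗g ∘ finToFun)

*-distribˡ-∑ᶜ : ∀ {n k} a (f : Colouring n k → ℕ) → a * ∑ᶜ f ≡ ∑ᶜ (λ φ → a * f φ)
*-distribˡ-∑ᶜ a f = *-distribˡ-sum a (f ∘ finToFun)

∑ᶜ-suc : ∀ {n k} (h : Colouring (suc n) k → ℕ) → (∀ {φ ψ} → φ ≗ ψ → h φ ≡ h ψ) →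
  ∑ᶜ h ≡ ∑[ c < k ] ∑ᶜ (λ φ → h (c ∷ᶠ φ))
∑ᶜ-suc {n} {k} h h-resp-≗ =
  trans (∑-combine k (h ∘ finToFun)) (sum-cong-≗ λ c → sum-cong-≗ λ ω → h-resp-≗ (finToFun-combine c ω))
  where
  finToFun-combine : ∀ c ω → finToFun (combine c ω) ≗ (c ∷ᶠ finToFun ω)
  finToFun-combine c ω zero    = cong proj₁ (remQuot-combine c ω)
  finToFun-combine c ω (suc w) = cong (λ qr → finToFun (proj₂ qr) w) (remQuot-combine c ω)

_IndependentOf_ : ∀ {n k} → (Colouring n k → ℕ) → Subset n → Set
h IndependentOf p = ∀ φ ψ → (∀ w → w ∉ p → φ w ≡ ψ w) → h φ ≡ h ψ

independent⇒resp-≗ : ∀ {n k} {p : Subset n} (h : Colouring n k → ℕ) → h IndependentOf p →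
  ∀ {φ ψ} → φ ≗ ψ → h φ ≡ h ψ
independent⇒resp-≗ h indep {φ} {ψ} φ≗ψ = indep φ ψ (λ w _ → φ≗ψ w)

independent-∷ : ∀ {n k x} {p : Subset n} {h : Colouring (suc n) k → ℕ} → h IndependentOf (x ∷ p) →
  ∀ c → (λ φ → h (c ∷ᶠ φ)) IndependentOf p
independent-∷ indep c φ ψ agree = indep (c ∷ᶠ φ) (c ∷ᶠ ψ) λ where
  zero    _   → refl
  (suc w) w∉p → agree w (w∉p ∘ there)

independent-product-map : ∀ {n k i} {I : Set i} {p : Subset n} {f : I → Colouring n k → ℕ} {S} →
  All (λ u → f u IndependentOf p) S → (λ φ → product (List.map (λ u → f u φ) S)) IndependentOf p
independent-product-map []               φ ψ agree = refl
independent-product-map (indep ∷ indeps) φ ψ agree =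
  cong₂ _*_ (indep φ ψ agree) (independent-product-map indeps φ ψ agree)

-- In terms of a uniformly random colouring φ: the values g (φ w) for w ∈ p are independent of each
-- other and of h, and have mean sum g / k.
∑ᶜ-∏∈-independent : ∀ {n k} (p : Subset n) (g : Fin k → ℕ) (h : Colouring n k → ℕ) → h IndependentOf p →
  k ^ ∣ p ∣ * ∑ᶜ (λ φ → ∏∈ p (g ∘ φ) * h φ) ≡ sum g ^ ∣ p ∣ * ∑ᶜ h
∑ᶜ-∏∈-independent []                  g h indep = cong (1 *_) (∑ᶜ-cong λ φ → *-identityˡ (h φ))
∑ᶜ-∏∈-independent {suc n} {k} (x ∷ p) g h indep = begin
  k ^ ∣ x ∷ p ∣ * ∑ᶜ (λ φ → ∏∈ (x ∷ p) (g ∘ φ) * h φ)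
    ≡⟨ cong (k ^ ∣ x ∷ p ∣ *_) (∑ᶜ-suc _ λ φ≗ψ →
         cong₂ _*_ (∏∈-cong (x ∷ p) λ {w} _ → cong g (φ≗ψ w)) (independent⇒resp-≗ h indep φ≗ψ)) ⟩
  k ^ ∣ x ∷ p ∣ * ∑[ c < k ] ∑ᶜ (λ φ → ∏∈ (x ∷ p) (g ∘ (c ∷ᶠ φ)) * h (c ∷ᶠ φ))
    ≡⟨ sum-over-first x indep ⟩
  sum g ^ ∣ x ∷ p ∣ * sum ∑h
    ≡⟨ cong (sum g ^ ∣ x ∷ p ∣ *_) (∑ᶜ-suc h (independent⇒resp-≗ h indep)) ⟨
  sum g ^ ∣ x ∷ p ∣ * ∑ᶜ h ∎
  where
  open ≡-Reasoning
  kˢ ∑gˢ : ℕ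
  kˢ  = k ^ ∣ p ∣
  ∑gˢ = sum g ^ ∣ p ∣
  ∑∏h ∑h : Fin k → ℕ
  ∑∏h c = ∑ᶜ (λ φ → ∏∈ p (g ∘ φ) * h (c ∷ᶠ φ))
  ∑h  c = ∑ᶜ (λ φ → h (c ∷ᶠ φ))
  ∑∏h∝∑h : ∀ c → kˢ * ∑∏h c ≡ ∑gˢ * ∑h c
  ∑∏h∝∑h c = ∑ᶜ-∏∈-independent p g (λ φ → h (c ∷ᶠ φ)) (independent-∷ indep c)
  sum-over-first : ∀ x → h IndependentOf (x ∷ p) →
    k ^ ∣ x ∷ p ∣ * ∑[ c < k ] ∑ᶜ (λ φ → ∏∈ (x ∷ p) (g ∘ (c ∷ᶠ φ)) * h (c ∷ᶠ φ)) ≡ sum g ^ ∣ x ∷ p ∣ * sum ∑h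
  sum-over-first outside _     = ∑-proportional kˢ ∑gˢ ∑∏h ∑h ∑∏h∝∑h
  sum-over-first inside  indep = begin
    k * kˢ * ∑[ c < k ] ∑ᶜ (λ φ → g c * ∏∈ p (g ∘ φ) * h (c ∷ᶠ φ))
                                 ≡⟨ cong (k * kˢ *_) (sum-cong-≗ factor-out) ⟩
    k * kˢ * sum (g ⊙ ∑∏h)       ≡⟨ *-assoc k kˢ (sum (g ⊙ ∑∏h)) ⟩
    k * (kˢ * sum (g ⊙ ∑∏h))     ≡⟨ cong (k *_) (∑-proportional kˢ ∑gˢ (g ⊙ ∑∏h) (g ⊙ ∑h) scaled) ⟩
    k * (∑gˢ * sum (g ⊙ ∑h))     ≡⟨ x∙yz≈y∙xz k ∑gˢ (sum (g ⊙ ∑h)) ⟩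
    ∑gˢ * (k * sum (g ⊙ ∑h))     ≡⟨ cong (∑gˢ *_) (∑-⊙-constant g ∑h ∑h-constant) ⟩
    ∑gˢ * (sum g * sum ∑h)       ≡⟨ x∙yz≈yx∙z ∑gˢ (sum g) (sum ∑h) ⟩
    sum g * ∑gˢ * sum ∑h         ∎
    where
    factor-out : ∀ c → ∑ᶜ (λ φ → g c * ∏∈ p (g ∘ φ) * h (c ∷ᶠ φ)) ≡ g c * ∑∏h c
    factor-out c = trans
      (∑ᶜ-cong λ φ → *-assoc (g c) (∏∈ p (g ∘ φ)) (h (c ∷ᶠ φ)))
      (sym (*-distribˡ-∑ᶜ (g c) λ φ → ∏∈ p (g ∘ φ) * h (c ∷ᶠ φ)))
    scaled : ∀ c → kˢ * (g c * ∑∏h c) ≡ ∑gˢ * (g c * ∑h c)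
    scaled c = begin
      kˢ * (g c * ∑∏h c)     ≡⟨ x∙yz≈y∙xz kˢ (g c) (∑∏h c) ⟩
      g c * (kˢ * ∑∏h c)     ≡⟨ cong (g c *_) (∑∏h∝∑h c) ⟩
      g c * (∑gˢ * ∑h c)     ≡⟨ x∙yz≈y∙xz (g c) ∑gˢ (∑h c) ⟩
      ∑gˢ * (g c * ∑h c)     ∎
    ∑h-constant : ∀ c d → ∑h c ≡ ∑h d
    ∑h-constant c d = ∑ᶜ-cong λ φ → indep (c ∷ᶠ φ) (d ∷ᶠ φ) λ where
      zero    0∉ → contradiction here 0∉
      (suc w) _  → refl

avoids : ∀ {k} → Fin k → Fin k → ℕ
avoids i c = if does (c ≟ᶠ i) then 0 else 1

∑-avoids : ∀ {j} (i : Fin (suc j)) → sum (avoids i) ≡ j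
∑-avoids {j}     zero    = trans (∑-const j 1) (*-identityʳ j)
∑-avoids {suc j} (suc i) = cong suc (∑-avoids i)

avoids≡0⇒≡ : ∀ {k} {i c : Fin k} → avoids i c ≡ 0 → c ≡ i
avoids≡0⇒≡ {i = i} {c} avoids≡0 with c ≟ᶠ i
... | yes c≡i = c≡i

#missing : ∀ {n k} → Subset n → Colouring n k → ℕ
#missing {k = k} p φ = ∑[ i < k ] ∏∈ p (avoids i ∘ φ)

#missing≡0⇒all-present : ∀ {n k} (p : Subset n) (φ : Colouring n k) → #missing p φ ≡ 0 →
  ∀ i → ∃ λ w → w ∈ p × φ w ≡ i
#missing≡0⇒all-present p φ #missing≡0 i =
  let w , w∈p , avoids≡0 = ∏∈≡0⇒∃≡0 p (avoids i ∘ φ) (∑≡0⇒≡0 (λ i → ∏∈ p (avoids i ∘ φ)) #missing≡0 i)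
  in w , w∈p , avoids≡0⇒≡ avoids≡0

#missing-independent : ∀ {n k} (p q : Subset n) → ¬ Nonempty (p ∩ q) → #missing {k = k} q IndependentOf p
#missing-independent p q p∩q≡∅ φ ψ agree = sum-cong-≗ λ i → ∏∈-cong q λ {w} w∈q →
  cong (avoids i) (agree w λ w∈p → p∩q≡∅ (w , x∈p∩q⁺ (w∈p , w∈q)))

∑ᶜ-#missing-independent : ∀ {n j} (p : Subset n) (h : Colouring n (suc j) → ℕ) → h IndependentOf p →
  suc j ^ ∣ p ∣ * ∑ᶜ (λ φ → #missing p φ * h φ) ≡ suc j * j ^ ∣ p ∣ * ∑ᶜ h
∑ᶜ-#missing-independent {n} {j} p h indep = begin
  k ^ ∣ p ∣ * ∑ᶜ (λ φ → #missing p φ * h φ)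
    ≡⟨ cong (k ^ ∣ p ∣ *_) ∑ᶜ-∑-comm ⟩
  k ^ ∣ p ∣ * ∑[ i < k ] ∑ᶜ (λ φ → ∏∈ p (avoids i ∘ φ) * h φ)
    ≡⟨ ∑-proportional (k ^ ∣ p ∣) (j ^ ∣ p ∣) _ (λ _ → ∑ᶜ h) one-colour ⟩
  j ^ ∣ p ∣ * ∑[ _ < k ] ∑ᶜ h
    ≡⟨ cong (j ^ ∣ p ∣ *_) (∑-const k (∑ᶜ h)) ⟩
  j ^ ∣ p ∣ * (k * ∑ᶜ h)
    ≡⟨ x∙yz≈yx∙z (j ^ ∣ p ∣) k (∑ᶜ h) ⟩
  k * j ^ ∣ p ∣ * ∑ᶜ h ∎
  where
  open ≡-Reasoning
  k = suc j
  ∑ᶜ-∑-comm : ∑ᶜ (λ φ → #missing p φ * h φ) ≡ ∑[ i < k ] ∑ᶜ (λ φ → ∏∈ p (avoids i ∘ φ) * h φ)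
  ∑ᶜ-∑-comm = trans
    (∑ᶜ-cong λ φ → *-distribʳ-sum (h φ) (λ i → ∏∈ p (avoids i ∘ φ)))
    (∑-comm λ ω i → ∏∈ p (avoids i ∘ finToFun ω) * h (finToFun ω))
  one-colour : ∀ i → k ^ ∣ p ∣ * ∑ᶜ (λ φ → ∏∈ p (avoids i ∘ φ) * h φ) ≡ j ^ ∣ p ∣ * ∑ᶜ h
  one-colour i = trans (∑ᶜ-∏∈-independent p (avoids i) h indep) (cong (λ s → s ^ ∣ p ∣ * ∑ᶜ h) (∑-avoids i))

∑ᶜ-#missing-rare : ∀ {n j} m (p : Subset n) (h : Colouring n (suc j) → ℕ) → h IndependentOf p →
  m * (suc j * j ^ ∣ p ∣) ≤ suc j ^ ∣ p ∣ → m * ∑ᶜ (λ φ → #missing p φ * h φ) ≤ ∑ᶜ h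
∑ᶜ-#missing-rare {n} {j} m p h indep mkjˢ≤kˢ = *-cancelˡ-≤ (k ^ ∣ p ∣) {{m^n≢0 k ∣ p ∣}} (begin
  k ^ ∣ p ∣ * (m * ∑ᶜ (λ φ → #missing p φ * h φ))    ≡⟨ x∙yz≈y∙xz (k ^ ∣ p ∣) m _ ⟩
  m * (k ^ ∣ p ∣ * ∑ᶜ (λ φ → #missing p φ * h φ))    ≡⟨ cong (m *_) (∑ᶜ-#missing-independent p h indep) ⟩
  m * (k * j ^ ∣ p ∣ * ∑ᶜ h)                         ≡⟨ *-assoc m (k * j ^ ∣ p ∣) (∑ᶜ h) ⟨
  m * (k * j ^ ∣ p ∣) * ∑ᶜ h                         ≤⟨ *-monoˡ-≤ (∑ᶜ h) mkjˢ≤kˢ ⟩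
  k ^ ∣ p ∣ * ∑ᶜ h                                   ∎)
  where
  open ≤-Reasoning
  k = suc j

-- Polychromatic colourings of hypergraphs

Hypergraph : ℕ → ℕ → Set
Hypergraph m n = Fin m → Subset n

dual : ∀ {m n} → Hypergraph m n → Hypergraph n m
dual E w = tabulate (λ e → lookup (E e) w)

Polychromatic : ∀ {m n k} → Hypergraph m n → Colouring n k → Set
Polychromatic E φ = ∀ e i → ∃ λ w → w ∈ E e × φ w ≡ i

∑-∣∩∣≤ : ∀ {m n K} (E : Hypergraph m n) → (∀ w → ∣ dual E w ∣ ≤ K) → ∀ p → ∑[ e < m ] ∣ p ∩ E e ∣ ≤ ∣ p ∣ * K
∑-∣∩∣≤ {m} {n} {K} E degree≤K p = begin
  ∑[ e < m ] ∣ p ∩ E e ∣                         ≡⟨ sum-cong-≗ ∣∩∣ ⟩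
  ∑[ e < m ] ∑[ w < n ] (⟦ p ⟧ w * ⟦ E e ⟧ w)    ≡⟨ ∑-comm {m} {n} _ ⟩
  ∑[ w < n ] ∑[ e < m ] (⟦ p ⟧ w * ⟦ E e ⟧ w)    ≡⟨ sum-cong-≗ (λ w → *-distribˡ-sum {m} (⟦ p ⟧ w) _) ⟨
  ∑[ w < n ] (⟦ p ⟧ w * ∑[ e < m ] ⟦ E e ⟧ w)    ≤⟨ ∑-mono-≤ (λ w → *-monoʳ-≤ (⟦ p ⟧ w) (∑⟦E⟧≤K w)) ⟩
  ∑[ w < n ] (⟦ p ⟧ w * K)                       ≡⟨ *-distribʳ-sum {n} K _ ⟨
  sum ⟦ p ⟧ * K                                  ≡⟨ cong (_* K) (∣p∣≡∑indicator p) ⟨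
  ∣ p ∣ * K                                      ∎
  where
  open ≤-Reasoning
  ⟦_⟧ : ∀ {n} → Subset n → Fin n → ℕ
  ⟦ p ⟧ w = indicator (lookup p w)
  indicator-∧ : ∀ x y → indicator (x ∧ y) ≡ indicator x * indicator y
  indicator-∧ true  y = sym (*-identityˡ (indicator y))
  indicator-∧ false y = refl
  ∣∩∣ : ∀ e → ∣ p ∩ E e ∣ ≡ ∑[ w < n ] (⟦ p ⟧ w * ⟦ E e ⟧ w)
  ∣∩∣ e = trans (∣p∣≡∑indicator (p ∩ E e)) (sum-cong-≗ λ w → trans
    (cong indicator (lookup-zipWith _∧_ w p (E e))) (indicator-∧ (lookup p w) (lookup (E e) w)))
  ∑⟦E⟧≤K : ∀ w → ∑[ e < m ] ⟦ E e ⟧ w ≤ K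
  ∑⟦E⟧≤K w = subst (_≤ K) (∣tabulate∣≡∑indicator λ e → lookup (E e) w) (degree≤K w)

polychromatic-colouring : ∀ {m n} (E : Hypergraph m n) j d K .{{_ : NonZero (d * K)}} →
  (∀ e → ∣ E e ∣ ≡ d) → (∀ w → ∣ dual E w ∣ ≤ K) → 4 * (d * K) * (suc j * j ^ d) ≤ suc j ^ d →
  ∃ λ (φ : Colouring n (suc j)) → Polychromatic E φ
polychromatic-colouring {m} {n} E j d K uniform degree≤K misses-rare =
  let ω , none-missing =
        lovász-local-lemma {_~_ = Meets} meets? (d * K) rare {{m^n≢0 (suc j) n}} (allFin m) sparse
  in finToFun ω , λ e → #missing≡0⇒all-present (E e) (finToFun ω) (All.lookup none-missing (∈-allFin e))
  where
  open ≤-Reasoning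
  X : Fin m → Fin (suc j ^ n) → ℕ
  X e ω = #missing (E e) (finToFun ω)
  open LocalLemma X
  Meets : Fin m → Fin m → Set
  Meets e f = Nonempty (E e ∩ E f)
  meets? : ∀ e f → Dec (Meets e f)
  meets? e f = nonempty? (E e ∩ E f)
  sparse : ∀ e → length (filter (meets? e) (allFin m)) ≤ d * K
  sparse e = begin
    length (filter (meets? e) (allFin m))
      ≤⟨ length-filter≤sum-map (meets? e) _ (m<n⇒0<n ∘ x∈p⇒∣p-x∣<∣p∣ ∘ proj₂) (allFin m) ⟩
    sumᴸ (List.map (λ f → ∣ E e ∩ E f ∣) (allFin m))
      ≡⟨ ∑-allFin (λ f → ∣ E e ∩ E f ∣) ⟩
    ∑[ f < m ] ∣ E e ∩ E f ∣
      ≤⟨ ∑-∣∩∣≤ E degree≤K (E e) ⟩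
    ∣ E e ∣ * K
      ≡⟨ cong (_* K) (uniform e) ⟩
    d * K ∎
  rare : ∀ e S → All (λ f → ¬ Meets e f) S → 4 * (d * K) * sum (X e ⊙ allVanish S) ≤ sum (allVanish S)
  rare e S disjoint = ∑ᶜ-#missing-rare (4 * (d * K)) (E e) _
    (independent-product-map (All.map vanishes-independent disjoint))
    (subst (λ s → 4 * (d * K) * (suc j * j ^ s) ≤ suc j ^ s) (sym (uniform e)) misses-rare)
    where
    vanishes-independent : ∀ {f} → ¬ Meets e f → (λ φ → 1 ∸ #missing {k = suc j} (E f) φ) IndependentOf E e
    vanishes-independent {f} e∩f≡∅ φ ψ agree = cong (1 ∸_) (#missing-independent (E e) (E f) e∩f≡∅ φ ψ agree)

-- Walks, cycles and paths in digraphs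

m/o≡n/o⇒n<o+m : ∀ m n o .{{_ : NonZero o}} → m / o ≡ n / o → n < o + m
m/o≡n/o⇒n<o+m m n o m/o≡n/o = begin-strict
  n                    ≡⟨ m≡m%n+[m/n]*n n o ⟩
  n % o + n / o * o    <⟨ +-monoˡ-< (n / o * o) (m%n<n n o) ⟩
  o + n / o * o        ≡⟨ cong (λ q → o + q * o) m/o≡n/o ⟨
  o + m / o * o        ≤⟨ +-monoʳ-≤ o (m/n*n≤m m o) ⟩
  o + m                ∎
  where open ≤-Reasoning

outNeighbours : ∀ {n} → Digraph n → Hypergraph n n
outNeighbours D v = tabulate (arc D v)

inNeighbours : ∀ {n} → Digraph n → Hypergraph n n
inNeighbours D v = tabulate (λ u → arc D u v)

module _ {n} (D : Digraph n) where

  ∣outNeighbours∣≡outdeg : ∀ v → ∣ outNeighbours D v ∣ ≡ outdeg D v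
  ∣outNeighbours∣≡outdeg v = trans (∣tabulate∣≡∑indicator (arc D v)) (sym (∑-allFin (indicator ∘ arc D v)))

  ∣inNeighbours∣≡indeg : ∀ v → ∣ inNeighbours D v ∣ ≡ indeg D v
  ∣inNeighbours∣≡indeg v =
    trans (∣tabulate∣≡∑indicator (λ u → arc D u v)) (sym (∑-allFin λ u → indicator (arc D u v)))

  outNeighbour⇒arc : ∀ {v w} → w ∈ outNeighbours D v → T (arc D v w)
  outNeighbour⇒arc w∈ = Equivalence.from T-≡ (∈-tabulate⁻ w∈)

  dual-⊆-inNeighbours : ∀ {E} → (∀ v → E v ⊆ outNeighbours D v) → ∀ w → dual E w ⊆ inNeighbours D w
  dual-⊆-inNeighbours {E} E⊆N⁺ w {v} v∈ =
    ∈-tabulate⁺ (∈-tabulate⁻ (E⊆N⁺ v (lookup⇒[]= w (E v) (∈-tabulate⁻ v∈))))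

  Rainbow : ∀ {k} → Colouring n k → Set
  Rainbow = Polychromatic (outNeighbours D)

  rainbow-colouring : ∀ j d K .{{_ : NonZero (d * K)}} → (∀ v → d ≤ outdeg D v) → (∀ v → indeg D v ≤ K) →
    4 * (d * K) * (suc j * j ^ d) ≤ suc j ^ d → ∃ λ (φ : Colouring n (suc j)) → Rainbow φ
  rainbow-colouring j d K d≤outdeg indeg≤K misses-rare =
    let φ , polychromatic = polychromatic-colouring E j d K (proj₂ ∘ proj₂ ∘ trimmed) degree≤K misses-rare
    in φ , λ v i → let w , w∈E , φw≡i = polychromatic v i in w , E⊆N⁺ v w∈E , φw≡i
    where
    trimmed : ∀ v → ∃ λ q → q ⊆ outNeighbours D v × ∣ q ∣ ≡ d
    trimmed v = ∃⊆-of-size d (outNeighbours D v) (subst (d ≤_) (sym (∣outNeighbours∣≡outdeg v)) (d≤outdeg v))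
    E : Hypergraph n n
    E = proj₁ ∘ trimmed
    E⊆N⁺ : ∀ v → E v ⊆ outNeighbours D v
    E⊆N⁺ = proj₁ ∘ proj₂ ∘ trimmed
    degree≤K : ∀ w → ∣ dual E w ∣ ≤ K
    degree≤K w = begin
      ∣ dual E w ∣            ≤⟨ p⊆q⇒∣p∣≤∣q∣ (dual-⊆-inNeighbours E⊆N⁺ w) ⟩
      ∣ inNeighbours D w ∣    ≡⟨ ∣inNeighbours∣≡indeg w ⟩
      indeg D w               ≤⟨ indeg≤K w ⟩
      K                       ∎
      where open ≤-Reasoning

  IsWalk : (ℕ → Fin n) → Set
  IsWalk w = ∀ t → T (arc D (w t) (w (suc t)))

  distinct-walk⇒path : ∀ {w} → IsWalk w → ∀ L →
    (∀ {s t : Fin (suc L)} → toℕ s < toℕ t → w (toℕ s) ≢ w (toℕ t)) → IsPath D L (w ∘ toℕ)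
  distinct-walk⇒path {w} walk L distinct = injective , λ t →
    subst (λ s → T (arc D (w s) (w (suc (toℕ t))))) (sym (toℕ-inject₁ t)) (walk (toℕ t))
    where
    injective : ∀ {s t : Fin (suc L)} → w (toℕ s) ≡ w (toℕ t) → s ≡ t
    injective {s} {t} ws≡wt with <ᶠ-cmp s t
    ... | tri< s<t _ _ = contradiction ws≡wt (distinct s<t)
    ... | tri≈ _ s≡t _ = s≡t
    ... | tri> _ _ t<s = contradiction (sym ws≡wt) (distinct t<s)

  GirthAtLeast : ℕ → Set
  GirthAtLeast g = ∀ k → HasCycleOfLength D k → g ≤ k

  girth≤closed-walk : ∀ {g w} → GirthAtLeast g → IsWalk w → ∀ m → Acc _<_ m → w 0 ≡ w (suc m) → g ≤ suc m
  girth≤closed-walk {w = w} girth walk m (acc rec) closed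
    with any? (λ (s : Fin (suc m)) → any? (λ t → (s <ᶠ? t) ×-dec (w (toℕ s) ≟ᶠ w (toℕ t))))
  ... | yes (s , t , s<t , ws≡wt) = ≤-trans
          (girth≤closed-walk girth (walk ∘ (_+ toℕ s)) l (rec l<m) (trans ws≡wt (cong w (sym 1+l+s≡t))))
          (<⇒≤ (s≤s l<m))
    where
    l = toℕ t ∸ suc (toℕ s)
    1+l+s≡t : suc l + toℕ s ≡ toℕ t
    1+l+s≡t = trans (sym (+-suc l (toℕ s))) (m∸n+n≡m s<t)
    l<m : l < m
    l<m = ≤-trans (m≤m+n (suc l) (toℕ s)) (≤-trans (≤-reflexive 1+l+s≡t) (≤-pred (toℕ<n t)))
  ... | no  no-repetition = girth (suc m) (w ∘ toℕ , proj₁ path , proj₂ path , last-arc)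
    where
    path : IsPath D m (w ∘ toℕ)
    path = distinct-walk⇒path walk m λ s<t ws≡wt → no-repetition (_ , _ , s<t , ws≡wt)
    last-arc : T (arc D (w (toℕ (fromℕ m))) (w 0))
    last-arc = subst₂ (λ x y → T (arc D x y)) (cong w (sym (toℕ-fromℕ m))) (sym closed) (walk m)

  girth≤repetition-gap : ∀ {g w a b} → GirthAtLeast g → IsWalk w → a < b → w a ≡ w b → g + a ≤ b
  girth≤repetition-gap {g} {w} {a} {b} girth walk a<b wa≡wb = subst (g + a ≤_) 1+m+a≡b (+-monoˡ-≤ a
    (girth≤closed-walk girth (walk ∘ (_+ a)) m (<-wellFounded m) (trans wa≡wb (cong w (sym 1+m+a≡b)))))
    where
    m = b ∸ suc a
    1+m+a≡b : suc m + a ≡ b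
    1+m+a≡b = trans (sym (+-suc m a)) (m∸n+n≡m a<b)

  rainbow⇒walk : ∀ {k} {φ : Colouring n k} → Rainbow φ → Fin n → (c : ℕ → Fin k) →
    ∃ λ w → IsWalk w × (∀ t → φ (w t) ≡ c t)
  rainbow⇒walk {φ = φ} rainbow v c = w , walk , φ∘w≗c
    where
    w : ℕ → Fin n
    w zero    = proj₁ (rainbow v (c 0))
    w (suc t) = proj₁ (rainbow (w t) (c (suc t)))
    walk : IsWalk w
    walk t = outNeighbour⇒arc (proj₁ (proj₂ (rainbow (w t) (c (suc t)))))
    φ∘w≗c : ∀ t → φ (w t) ≡ c t
    φ∘w≗c zero    = proj₂ (proj₂ (rainbow v (c 0)))
    φ∘w≗c (suc t) = proj₂ (proj₂ (rainbow (w t) (c (suc t))))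

  rainbow⇒path : ∀ {j g} {φ : Colouring n (suc j)} → Rainbow φ → GirthAtLeast (suc g) → Fin n →
    HasPath D (pred (suc j * suc g))
  rainbow⇒path {j} {g} {φ} rainbow girth v =
    let w , walk , φ∘w≗block = rainbow⇒walk rainbow v block
        same-block : ∀ s t → w (toℕ s) ≡ w (toℕ t) → toℕ s / suc g ≡ toℕ t / suc g
        same-block s t ws≡wt = begin
          toℕ s / suc g            ≡⟨ toℕ-block s ⟨
          toℕ (block (toℕ s))      ≡⟨ cong toℕ (φ∘w≗block (toℕ s)) ⟨
          toℕ (φ (w (toℕ s)))      ≡⟨ cong (toℕ ∘ φ) ws≡wt ⟩
          toℕ (φ (w (toℕ t)))      ≡⟨ cong toℕ (φ∘w≗block (toℕ t)) ⟩
          toℕ (block (toℕ t))      ≡⟨ toℕ-block t ⟩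
          toℕ t / suc g            ∎
    in w ∘ toℕ , distinct-walk⇒path walk _ λ {s} {t} s<t ws≡wt → <⇒≱
         (m/o≡n/o⇒n<o+m (toℕ s) (toℕ t) (suc g) (same-block s t ws≡wt))
         (girth≤repetition-gap girth walk s<t ws≡wt)
    where
    open ≡-Reasoning
    block : ℕ → Fin (suc j)
    block t = (t / suc g) mod suc j
    toℕ-block : ∀ (t : Fin (suc j * suc g)) → toℕ (block (toℕ t)) ≡ toℕ t / suc g
    toℕ-block t = trans (toℕ-fromℕ< _) (m<n⇒m%n≡m (m<n*o⇒m/o<n (toℕ<n t)))

  arc⇒path : ∀ {v w} → v ≢ w → T (arc D v w) → HasPath D 1
  arc⇒path {v} {w} v≢w v→w = p , injective , λ { zero → v→w }
    where
    p : Fin 2 → Fin n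
    p zero       = v
    p (suc zero) = w
    injective : ∀ {i j} → p i ≡ p j → i ≡ j
    injective {zero}     {zero}     _   = refl
    injective {zero}     {suc zero} v≡w = contradiction v≡w v≢w
    injective {suc zero} {zero}     w≡v = contradiction (sym w≡v) v≢w
    injective {suc zero} {suc zero} _   = refl

  -- The path with k g vertices is too short only if k = g = 1; there may then be loops, but not
  -- only loops.
  rainbow⇒long-path : ∀ {j g} {φ : Colouring n (suc j)} → Rainbow φ → (∀ v → 2 ≤ outdeg D v) → Girth D g →
    ∃ λ L → HasPath D L × suc j * g ≤ 2 * L
  rainbow⇒long-path {g = zero}  _       _        (() , _)
  rainbow⇒long-path {j} {suc g} rainbow 2≤outdeg ((cycle , _) , girth)
    with g + j * suc g | rainbow⇒path rainbow girth (cycle zero)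
  ... | suc L | path = suc L , path , s≤s (≤-trans (s≤s (m≤m+n L 0)) (m≤n+m (suc (L + 0)) L))
  ... | zero  | _    =
    let 2≤∣N⁺∣ = subst (2 ≤_) (sym (∣outNeighbours∣≡outdeg v)) (2≤outdeg v)
        w , w∈N⁺ , v≢w = 2≤∣p∣⇒∃≢ (outNeighbours D v) v 2≤∣N⁺∣
    in 1 , arc⇒path v≢w (outNeighbour⇒arc w∈N⁺) , s≤s z≤n
    where v = cycle zero

  long-path : ∀ a {d g} → 2 ≤ d → (∀ v → d ≤ outdeg D v) → (∀ v → indeg D v ≤ 2 ^ a * d) → Girth D g →
    ∃ λ L → HasPath D L × d * g ≤ 4 * (8 + a) * (⌊log₂ d ⌋ * L)
  long-path a {d} {g} 2≤d d≤outdeg indeg≤2ᵃd girth =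
    let j , k≤d , d≤2tk , decay = ∃k-2^t*[k-1]^d≤k^d t d
        φ , rainbow = rainbow-colouring j d (2 ^ a * d) d≤outdeg indeg≤2ᵃd (misses-rare k≤d decay)
        L , path , kg≤2L = rainbow⇒long-path rainbow (λ v → ≤-trans 2≤d (d≤outdeg v)) girth
    in L , path , (begin
      d * g                            ≤⟨ *-monoˡ-≤ g d≤2tk ⟩
      2 * t * suc j * g                ≡⟨ *-assoc (2 * t) (suc j) g ⟩
      2 * t * (suc j * g)              ≤⟨ *-monoʳ-≤ (2 * t) kg≤2L ⟩
      2 * t * (2 * L)                  ≡⟨ collect a ⌊log₂ d ⌋ L ⟩
      4 * (8 + a) * (⌊log₂ d ⌋ * L)    ∎)
    where
    open ≤-Reasoning
    t = (8 + a) * ⌊log₂ d ⌋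
    instance
      d≢0 : NonZero d
      d≢0 = >-nonZero (<⇒≤ 2≤d)
      t≢0 : NonZero t
      t≢0 = m*n≢0 (8 + a) ⌊log₂ d ⌋ {{_}} {{>-nonZero (⌊log₂⌋-mono-≤ 2≤d)}}
      d*2ᵃd≢0 : NonZero (d * (2 ^ a * d))
      d*2ᵃd≢0 = m*n≢0 d (2 ^ a * d) {{d≢0}} {{m*n≢0 (2 ^ a) d {{m^n≢0 2 a}}}}
    misses-rare : ∀ {j} → suc j ≤ d → 2 ^ t * j ^ d ≤ suc j ^ d →
      4 * (d * (2 ^ a * d)) * (suc j * j ^ d) ≤ suc j ^ d
    misses-rare {j} k≤d decay = begin
      4 * (d * (2 ^ a * d)) * (suc j * j ^ d)    ≤⟨ *-monoʳ-≤ (4 * (d * (2 ^ a * d))) (*-monoˡ-≤ (j ^ d) k≤d) ⟩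
      4 * (d * (2 ^ a * d)) * (d * j ^ d)        ≡⟨ cube d (2 ^ a) (j ^ d) ⟩
      4 * (2 ^ a * (d * (d * d))) * j ^ d        ≤⟨ *-monoˡ-≤ (j ^ d) (4*2^a*d³≤2^[8+a]⌊log₂d⌋ a 2≤d) ⟩
      2 ^ t * j ^ d                              ≤⟨ decay ⟩
      suc j ^ d                                  ∎
      where
      cube : ∀ d x y → 4 * (d * (x * d)) * (d * y) ≡ 4 * (x * (d * (d * d))) * y
      cube = solve-∀
    collect : ∀ a l L → 2 * ((8 + a) * l) * (2 * L) ≡ 4 * (8 + a) * (l * L)
    collect = solve-∀

-- Natural numbers as rationals

toℚᵘ-ℕtoℚ : ∀ m → toℚᵘ (ℕtoℚ m) ≃ mkℚᵘ (ℤ.+ m) 0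
toℚᵘ-ℕtoℚ m = ℚ.toℚᵘ-fromℚᵘ (mkℚᵘ (ℤ.+ m) 0)

p≤∣↥p∣ : ∀ p → toℚᵘ p ℚᵘ.≤ mkℚᵘ (ℤ.+ ℤ.∣ ↥ p ∣) 0
p≤∣↥p∣ (mkℚ (ℤ.+ n)  d-1 _) = *≤*
  (subst₂ ℤ._≤_ (ℤ.pos-* n 1) (ℤ.pos-* n (suc d-1)) (ℤ.+≤+ (*-monoʳ-≤ n z<s)))
p≤∣↥p∣ (mkℚ -[1+ n ] d-1 _) = *≤* ℤ.-≤+

ℕtoℚ[m]≤C*ℕtoℚ[d]⇒m≤∣↥C∣*d : ∀ C m d → ℕtoℚ m ℚ.≤ C ℚ.* ℕtoℚ d → m ≤ ℤ.∣ ↥ C ∣ * d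
ℕtoℚ[m]≤C*ℕtoℚ[d]⇒m≤∣↥C∣*d C m d m≤Cd = ℤ.drop‿+≤+ (subst₂ ℤ._≤_
  (ℤ.*-identityʳ (ℤ.+ m)) (trans (ℤ.*-identityʳ _) (sym (ℤ.pos-* c d))) (ℚᵘ.drop-*≤* (begin
    mkℚᵘ (ℤ.+ m) 0                          ≃⟨ toℚᵘ-ℕtoℚ m ⟨
    toℚᵘ (ℕtoℚ m)                           ≤⟨ ℚ.toℚᵘ-mono-≤ m≤Cd ⟩
    toℚᵘ (C ℚ.* ℕtoℚ d)                     ≃⟨ ℚ.toℚᵘ-homo-* C (ℕtoℚ d) ⟩
    toℚᵘ C ℚᵘ.* toℚᵘ (ℕtoℚ d)               ≃⟨ ℚᵘ.*-congˡ {toℚᵘ C} (toℚᵘ-ℕtoℚ d) ⟩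
    toℚᵘ C ℚᵘ.* mkℚᵘ (ℤ.+ d) 0              ≤⟨ ℚᵘ.*-monoˡ-≤-nonNeg (mkℚᵘ (ℤ.+ d) 0) (p≤∣↥p∣ C) ⟩
    mkℚᵘ (ℤ.+ c) 0 ℚᵘ.* mkℚᵘ (ℤ.+ d) 0      ∎)))
  where
  open ℚᵘ.≤-Reasoning
  c = ℤ.∣ ↥ C ∣

theorem3 : ∀ (C : ℚ) → 0ℚ <ℚ C →
  Σ ℕ λ p → Σ ℕ λ q → (0 < q) × (q < p) ×
    (∀ (d n g : ℕ) (D : Digraph n) → 2 ≤ d → Regular C d D → Girth D g →
      Σ ℕ λ L → HasPath D L × (p ^ (d * g) ≤ (d ^ L) * (q ^ (d * g))))
theorem3 C _ = suc q , q , z<s , ≤-refl , λ d n g D 2≤d regular girth →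
  let ℓ = ⌊log₂ d ⌋
      indeg≤ad  = λ v → ℕtoℚ[m]≤C*ℕtoℚ[d]⇒m≤∣↥C∣*d C (indeg D v) d (proj₂ (regular v))
      indeg≤2ᵃd = λ v → ≤-trans (indeg≤ad v) (*-monoˡ-≤ d (n≤2^n a))
      L , path , dg≤mℓL = long-path D a 2≤d (proj₁ ∘ regular) indeg≤2ᵃd girth
  in L , path , (begin
    suc q ^ (d * g)              ≤⟨ a^e≤c^s*b^e {c = 2} m (ℓ * L) (n≤1+n q) [1+q]^m≤2*q^m dg≤mℓL ⟩
    2 ^ (ℓ * L) * q ^ (d * g)    ≡⟨ cong (_* q ^ (d * g)) (^-*-assoc 2 ℓ L) ⟨
    (2 ^ ℓ) ^ L * q ^ (d * g)    ≤⟨ *-monoˡ-≤ (q ^ (d * g)) (^-monoˡ-≤ L (2^⌊log₂n⌋≤n d {{>-nonZero (<⇒≤ 2≤d)}})) ⟩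
    d ^ L * q ^ (d * g)          ∎)
  where
  open ≤-Reasoning
  a = ℤ.∣ ↥ C ∣
  m = 4 * (8 + a)
  q = pred (2 * m)
  [1+q]^m≤2*q^m : suc q ^ m ≤ 2 * q ^ m
  [1+q]^m≤2*q^m = [r+q]^m≤2*q^m q 1 m (≤-reflexive (cong (2 *_) (*-identityʳ m)))
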